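{- Let $n$ be an odd positive integer, let $a \in \mathbf{F}_q$ be a nonzero element that is a square in $\mathbf{F}_q$, and let $\sqrt{a} \in \mathbf{F}_q$ denote a square root of $a$. Let $f(x)=\sum_{i=0}^n b_i x^i \in \mathbf{F}_q[x]$ be an $a$-self reciprocal monic polynomial of degree $n$. (1) If $b_0 = (\sqrt{a})^n$, then $f(x)$ is divisible by $x+\sqrt{a}$. (2) If $b_0 = -(\sqrt{a})^n$, then $f(x)$ is divisible by $x-\sqrt{a}$.
   Context: Let $q=p^e$ be an odd prime power and $\mathbf{F}_q$ the finite field with $q$ elements. For a nonzero $a\in\mathbf{F}_q$ and a monic polynomial $f(x)=\sum_{i=0}^n b_i x^i \in \mathbf{F}_q[x]$ of degree $n$ with $f(0)\neq 0$, the $a$-reciprocal of $f$ is $\hat{f}_a(x) := \frac{x^n}{f(0)} f\left(\frac{a}{x}\right) = \frac{1}{b_0}\sum_{i=0}^n b_i a^i x^{n-i}$. A monic polynomial $f(x)$ (with $f(0)\ne 0$) is $a$-self reciprocal if $\hat{f}_a(x)=f(x)$; equivalently $b_{n-i}b_0=b_i a^i$ for each $i$. -}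

module Defs where

open import Algebra.Bundles using (CommutativeRing)
open import Algebra.Bundles.Raw using (RawRing)
import Algebra.Definitions
import Algebra.Definitions.RawSemiring as RawSemiringDefinitions
open import Data.Fin using (Fin; toℕ)
open import Data.List using (List; []; _∷_; _++_; map; replicate)
open import Data.Nat as ℕ using (ℕ; zero; suc; NonZero)
open import Data.Nat.Divisibility using (_∤_)
open import Data.Nat.Primality using (Prime)
open import Data.Product using (Σ-syntax; _×_; proj₁)
open import Function.Bundles using (Inverse)
open import Level using (Level; _⊔_)
open import Relation.Binary.PropositionalEquality as ≡ using (_≡_)

Odd : ℕ → Set
Odd n = 2 ∤ n

record OddPrimePower (q : ℕ) : Set where
  field
    p e       : ℕ
    p-prime   : Prime p
    e-nonZero : NonZero e
    q≡p^e     : q ≡ p ℕ.^ e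
    q-odd     : Odd q

-- The enumeration makes _≈_ decidable, so "nonzero" is plain _≉ 0#; the
-- apartness relation of the library's HeytingField is not needed.
record FiniteField (c ℓ : Level) (q : ℕ) : Set (Level.suc (c ⊔ ℓ)) where
  field
    commutativeRing : CommutativeRing c ℓ

  open CommutativeRing commutativeRing public
  open Algebra.Definitions _≈_ using (Invertible)
  open RawSemiringDefinitions
    (RawRing.rawSemiring (CommutativeRing.rawRing commutativeRing)) public
    using (_^_)

  field
    1≉0         : 1# ≉ 0#
    invertible  : ∀ x → x ≉ 0# → Invertible 1# _*_ x
    cardinality : Inverse setoid (≡.setoid (Fin q))

  inverse : ∀ x → x ≉ 0# → Carrier
  inverse x x≉0 = proj₁ (invertible x x≉0)

-- Polynomials are lists of coefficients, constant term first. Trailing zeros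
-- are allowed, so equality compares the coefficients at every index.
module Polynomial {c ℓ} (R : CommutativeRing c ℓ) where
  open CommutativeRing R

  infix  4 _≈ᵖ_
  infixl 6 _+ᵖ_ _-ᵖ_
  infixl 7 _*ᵖ_ _·ᵖ_
  infix  8 -ᵖ_

  Poly : Set c
  Poly = List Carrier

  coeff : Poly → ℕ → Carrier
  coeff []      _       = 0#
  coeff (b ∷ f) zero    = b
  coeff (b ∷ f) (suc k) = coeff f k

  _≈ᵖ_ : Poly → Poly → Set ℓ
  f ≈ᵖ g = ∀ k → coeff f k ≈ coeff g k

  _+ᵖ_ : Poly → Poly → Poly
  []      +ᵖ g       = g
  (b ∷ f) +ᵖ []      = b ∷ f
  (b ∷ f) +ᵖ (d ∷ g) = (b + d) ∷ (f +ᵖ g)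

  _·ᵖ_ : Carrier → Poly → Poly
  d ·ᵖ f = map (d *_) f

  _*ᵖ_ : Poly → Poly → Poly
  []      *ᵖ g = []
  (b ∷ f) *ᵖ g = (b ·ᵖ g) +ᵖ (0# ∷ (f *ᵖ g))

  -ᵖ_ : Poly → Poly
  -ᵖ f = map -_ f

  _-ᵖ_ : Poly → Poly → Poly
  f -ᵖ g = f +ᵖ (-ᵖ g)

  C : Carrier → Poly
  C b = b ∷ []

  X : Poly
  X = 0# ∷ 1# ∷ []

  -- b xᵏ
  monomial : Carrier → ℕ → Poly
  monomial b k = replicate k 0# ++ C b

  rawRingᵖ : RawRing c ℓ
  rawRingᵖ = record
    { Carrier = Poly
    ; _≈_     = _≈ᵖ_
    ; _+_     = _+ᵖ_
    ; _*_     = _*ᵖ_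
    ; -_      = -ᵖ_
    ; 0#      = []
    ; 1#      = C 1#
    }

  open RawSemiringDefinitions (RawRing.rawSemiring rawRingᵖ) public
    using () renaming (_∣_ to _∣ᵖ_; sum to sumᵖ)

  MonicOfDegree : ℕ → Poly → Set ℓ
  MonicOfDegree n f = (coeff f n ≈ 1#) × (∀ k → n ℕ.< k → coeff f k ≈ 0#)

module Reciprocal {c ℓ q} (F : FiniteField c ℓ q) where
  open FiniteField F
  open Polynomial commutativeRing public

  -- (xⁿ / f(0)) f(a/x) = (1 / b₀) Σ_{i=0}^{n} bᵢ aⁱ xⁿ⁻ⁱ for f = Σ bᵢ xⁱ of
  -- degree n, where f(0) = b₀.
  reciprocal : Carrier → (n : ℕ) (f : Poly) → coeff f 0 ≉ 0# → Poly
  reciprocal a n f b₀≉0 =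
    inverse (coeff f 0) b₀≉0 ·ᵖ
      sumᵖ {suc n} (λ i → monomial (coeff f (toℕ i) * a ^ toℕ i) (n ℕ.∸ toℕ i))

  SelfReciprocal : Carrier → ℕ → Poly → Set ℓ
  SelfReciprocal a n f =
    Σ[ b₀≉0 ∈ coeff f 0 ≉ 0# ] (reciprocal a n f b₀≉0 ≈ᵖ f)

{-# OPTIONS --safe #-}

-- Let t² = a and let f = Σ bᵢ xⁱ be a-self reciprocal of degree n. Since
-- aⁱ tⁿ⁻ⁱ = tⁿ tⁱ, evaluating the reciprocal at t gives (tⁿ / b₀) f(t), so
-- f(t) = (tⁿ / b₀) f(t). If b₀ = - tⁿ, this says f(t) = - f(t), whence
-- f(t) = 0 in odd characteristic, and x - t divides f. Part (1) is the case
-- t = - √a, where n odd gives tⁿ = - (√a)ⁿ; part (2) is the case t = √a.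
--
-- That 1 + 1 ≉ 0 follows from q · 1 = 0 with q odd, and q · 1 = 0 follows by
-- summing over all elements x and over their translates x + 1.
module Submission where

open import Defs
open import Algebra.Bundles using (CommutativeRing)
import Algebra.Properties.AbelianGroup
import Algebra.Properties.CommutativeSemigroup
import Algebra.Properties.CommutativeSemiring.Exp
import Algebra.Properties.Ring
import Algebra.Properties.Semiring.Mult
import Algebra.Properties.Semiring.Sum
open import Data.Fin using (Fin; toℕ)
open import Data.Fin.Permutation using (Permutation′; permutation; _⟨$⟩ʳ_)
open import Data.Fin.Properties using (toℕ≤pred[n])
open import Data.List using ([]; _∷_)
open import Data.Nat as ℕ using (ℕ; zero; suc; z≤n; s≤s)
open import Data.Nat.DivMod using (_/_; _%_; m%n<n; m≡m%n+[m/n]*n)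
open import Data.Nat.Divisibility using (m%n≡0⇒n∣m)
import Data.Nat.Properties as ℕ
open import Data.Product using (∃-syntax; _×_; _,_; proj₁; proj₂)
open import Function using (_∘_)
open import Function.Bundles using (Inverse)
open import Relation.Binary.PropositionalEquality as ≡ using (_≡_)
import Relation.Binary.Reasoning.Setoid
open import Relation.Nullary using (contradiction)

-- Parity and exponent arithmetic.

odd⇒1+2k : ∀ n → Odd n → ∃[ k ] n ≡ suc (2 ℕ.* k)
odd⇒1+2k n odd with n % 2 in eq | m%n<n n 2 | m≡m%n+[m/n]*n n 2
... | 0           | _             | _  = contradiction (m%n≡0⇒n∣m n 2 eq) odd
... | 1           | _             | n≡ = n / 2 , ≡.trans n≡ (≡.cong suc (ℕ.*-comm (n / 2) 2))
... | suc (suc _) | s≤s (s≤s ())  | _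

-- Exponent count for `(t ^ 2) ^ i * t ^ (n ℕ.∸ i)`; `i ℕ.≤ n` keeps the truncated subtraction
-- exact.
2i+[n∸i]≡n+i : ∀ {i n} → i ℕ.≤ n → 2 ℕ.* i ℕ.+ (n ℕ.∸ i) ≡ n ℕ.+ i
2i+[n∸i]≡n+i {i} {n} i≤n = begin
  i ℕ.+ (i ℕ.+ 0) ℕ.+ (n ℕ.∸ i) ≡⟨ ≡.cong (λ j → i ℕ.+ j ℕ.+ (n ℕ.∸ i)) (ℕ.+-identityʳ i) ⟩
  i ℕ.+ i ℕ.+ (n ℕ.∸ i)         ≡⟨ ℕ.+-assoc i i _ ⟩
  i ℕ.+ (i ℕ.+ (n ℕ.∸ i))       ≡⟨ ≡.cong (i ℕ.+_) (ℕ.m+[n∸m]≡n i≤n) ⟩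
  i ℕ.+ n                       ≡⟨ ℕ.+-comm i n ⟩
  n ℕ.+ i                       ∎
  where open ≡.≡-Reasoning

-- Evaluation, and division by a monic linear polynomial.

module PolynomialProperties {c ℓ} (R : CommutativeRing c ℓ) where
  open CommutativeRing R
  open Polynomial R
  open Relation.Binary.Reasoning.Setoid setoid
  open Algebra.Properties.CommutativeSemiring.Exp commutativeSemiring
  open Algebra.Properties.Semiring.Sum semiring
  open Algebra.Properties.Ring ring using (-‿distribˡ-*; -‿distribʳ-*)
  open Algebra.Properties.AbelianGroup +-abelianGroup using (⁻¹-involutive)
  open Algebra.Properties.CommutativeSemigroup +-commutativeSemigroup
    using (interchange)
  open Algebra.Properties.CommutativeSemigroup *-commutativeSemigroup
    using (x∙yz≈y∙xz)

  [-x]²≈x² : ∀ x → (- x) ^ 2 ≈ x ^ 2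
  [-x]²≈x² x = begin
    - x * (- x * 1#)   ≈⟨ *-congˡ (-‿distribˡ-* x 1#) ⟨
    - x * - (x * 1#)   ≈⟨ -‿distribˡ-* x _ ⟨
    - (x * - (x * 1#)) ≈⟨ -‿cong (-‿distribʳ-* x _) ⟨
    - - (x * (x * 1#)) ≈⟨ ⁻¹-involutive _ ⟩
    x * (x * 1#)       ∎

  -- The even part of the power depends only on the square, so just the leading factor contributes a
  -- sign.
  [-x]^[1+2k]≈-x^[1+2k] : ∀ x k → (- x) ^ suc (2 ℕ.* k) ≈ - (x ^ suc (2 ℕ.* k))
  [-x]^[1+2k]≈-x^[1+2k] x k = begin
    - x * (- x) ^ (2 ℕ.* k) ≈⟨ *-congˡ (^-assocʳ (- x) 2 k) ⟨
    - x * ((- x) ^ 2) ^ k   ≈⟨ *-congˡ (^-congˡ k ([-x]²≈x² x)) ⟩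
    - x * (x ^ 2) ^ k       ≈⟨ *-congˡ (^-assocʳ x 2 k) ⟩
    - x * x ^ (2 ℕ.* k)     ≈⟨ -‿distribˡ-* x _ ⟨
    - (x * x ^ (2 ℕ.* k))   ∎

  coeff-+ᵖ : ∀ f g k → coeff (f +ᵖ g) k ≈ coeff f k + coeff g k
  coeff-+ᵖ []      g       k       = sym (+-identityˡ _)
  coeff-+ᵖ (b ∷ f) []      k       = sym (+-identityʳ _)
  coeff-+ᵖ (b ∷ f) (d ∷ g) zero    = refl
  coeff-+ᵖ (b ∷ f) (d ∷ g) (suc k) = coeff-+ᵖ f g k

  coeff-C-cong : ∀ {b d} → b ≈ d → C b ≈ᵖ C d
  coeff-C-cong b≈d zero    = b≈d
  coeff-C-cong b≈d (suc k) = refl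

  eval : Poly → Carrier → Carrier
  eval []      x = 0#
  eval (b ∷ f) x = b + x * eval f x

  eval-zero : ∀ f x → f ≈ᵖ [] → eval f x ≈ 0#
  eval-zero []      x f≈0 = refl
  eval-zero (b ∷ f) x f≈0 = begin
    b + x * eval f x ≈⟨ +-cong (f≈0 0) (*-congˡ (eval-zero f x (f≈0 ∘ suc))) ⟩
    0# + x * 0#      ≈⟨ +-identityˡ _ ⟩
    x * 0#           ≈⟨ zeroʳ x ⟩
    0#               ∎

  -- Equal polynomials may be lists of different lengths; the surplus tail has only zero
  -- coefficients and is left to `eval-zero`.
  eval-cong : ∀ f g x → f ≈ᵖ g → eval f x ≈ eval g x
  eval-cong []      g       x f≈g = sym (eval-zero g x (sym ∘ f≈g))
  eval-cong (b ∷ f) []      x f≈g = eval-zero (b ∷ f) x f≈g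
  eval-cong (b ∷ f) (d ∷ g) x f≈g =
    +-cong (f≈g 0) (*-congˡ (eval-cong f g x (f≈g ∘ suc)))

  eval-+ᵖ : ∀ f g x → eval (f +ᵖ g) x ≈ eval f x + eval g x
  eval-+ᵖ []      g       x = sym (+-identityˡ _)
  eval-+ᵖ (b ∷ f) []      x = sym (+-identityʳ _)
  eval-+ᵖ (b ∷ f) (d ∷ g) x = begin
    (b + d) + x * eval (f +ᵖ g) x             ≈⟨ +-congˡ (*-congˡ (eval-+ᵖ f g x)) ⟩
    (b + d) + x * (eval f x + eval g x)       ≈⟨ +-congˡ (distribˡ x _ _) ⟩
    (b + d) + (x * eval f x + x * eval g x)   ≈⟨ interchange _ _ _ _ ⟩
    (b + x * eval f x) + (d + x * eval g x)   ∎

  eval-·ᵖ : ∀ d f x → eval (d ·ᵖ f) x ≈ d * eval f x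
  eval-·ᵖ d []      x = sym (zeroʳ d)
  eval-·ᵖ d (b ∷ f) x = begin
    d * b + x * eval (d ·ᵖ f) x ≈⟨ +-congˡ (*-congˡ (eval-·ᵖ d f x)) ⟩
    d * b + x * (d * eval f x)  ≈⟨ +-congˡ (x∙yz≈y∙xz x d _) ⟩
    d * b + d * (x * eval f x)  ≈⟨ distribˡ d _ _ ⟨
    d * (b + x * eval f x)      ∎

  eval-monomial : ∀ b k x → eval (monomial b k) x ≈ b * x ^ k
  eval-monomial b zero    x = begin
    b + x * 0# ≈⟨ +-congˡ (zeroʳ x) ⟩
    b + 0#     ≈⟨ +-identityʳ b ⟩
    b          ≈⟨ *-identityʳ b ⟨
    b * 1#     ∎
  eval-monomial b (suc k) x = begin
    0# + x * eval (monomial b k) x ≈⟨ +-identityˡ _ ⟩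
    x * eval (monomial b k) x      ≈⟨ *-congˡ (eval-monomial b k x) ⟩
    x * (b * x ^ k)                ≈⟨ x∙yz≈y∙xz x b _ ⟩
    b * (x * x ^ k)                ∎

  eval-sumᵖ : ∀ {m} (fs : Fin m → Poly) x →
              eval (sumᵖ fs) x ≈ sum (λ i → eval (fs i) x)
  eval-sumᵖ {zero}  fs x = refl
  eval-sumᵖ {suc m} fs x =
    trans (eval-+ᵖ (fs Fin.zero) _ x) (+-congˡ (eval-sumᵖ (fs ∘ Fin.suc) x))

  -- Passes from Horner's form to an indexed sum. The bound `m` is exclusive and independent of the
  -- length of the list, which may exceed `m` by trailing zeros or fall short of it.
  eval≈∑ : ∀ m f x → (∀ k → m ℕ.≤ k → coeff f k ≈ 0#) →
           eval f x ≈ sum {m} (λ i → coeff f (toℕ i) * x ^ toℕ i)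
  eval≈∑ zero    f       x bound = eval-zero f x (λ k → bound k z≤n)
  eval≈∑ (suc m) []      x bound = begin
    0#                                            ≈⟨ sum-replicate-zero (suc m) ⟨
    sum {suc m} (λ _ → 0#)                        ≈⟨ sum-cong-≋ {suc m} (λ i → zeroˡ (x ^ toℕ i)) ⟨
    sum {suc m} (λ i → 0# * x ^ toℕ i)            ∎
  eval≈∑ (suc m) (b ∷ f) x bound = begin
    b + x * eval f x
      -- The factor `1#` is `x ^ 0` in the summand of index zero.
      ≈⟨ +-cong (*-identityʳ b) (*-congˡ (sym (eval≈∑ m f x (λ k m≤k → bound (suc k) (s≤s m≤k))))) ⟨
    b * 1# + x * sum {m} (λ i → coeff f (toℕ i) * x ^ toℕ i)
      ≈⟨ +-congˡ (*-distribˡ-sum {m} x _) ⟩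
    b * 1# + sum {m} (λ i → x * (coeff f (toℕ i) * x ^ toℕ i))
      ≈⟨ +-congˡ (sum-cong-≋ {m} (λ i → x∙yz≈y∙xz x _ _)) ⟩
    b * 1# + sum {m} (λ i → coeff f (toℕ i) * (x * x ^ toℕ i))
      ∎

  -- Horner's scheme: the quotient of f by x - t, whose remainder is f(t).
  quotient : Carrier → Poly → Poly
  quotient t []      = []
  quotient t (b ∷ f) = eval f t ∷ quotient t f

  -- The divisor is x + d with root `t`. Asking for `d + t ≈ 0#`, rather than fixing `d` as `- t`,
  -- covers both signs of the linear factor.
  quotient-remainder : ∀ {d t} → d + t ≈ 0# → ∀ f →
    C (eval f t) +ᵖ quotient t f *ᵖ (d ∷ 1# ∷ []) ≈ᵖ f
  quotient-remainder         d+t≈0 []      zero    = refl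
  quotient-remainder         d+t≈0 []      (suc k) = refl
  quotient-remainder {d} {t} d+t≈0 (b ∷ f) zero    = begin
    -- The last `0#` is the constant term of the shifted summand in `_*ᵖ_`.
    (b + t * v) + (v * d + 0#) ≈⟨ +-congˡ (+-identityʳ _) ⟩
    (b + t * v) + v * d        ≈⟨ +-assoc b _ _ ⟩
    b + (t * v + v * d)        ≈⟨ +-congˡ (+-comm _ _) ⟩
    b + (v * d + t * v)        ≈⟨ +-congˡ (+-congˡ (*-comm t v)) ⟩
    b + (v * d + v * t)        ≈⟨ +-congˡ (distribˡ v d t) ⟨
    b + v * (d + t)            ≈⟨ +-congˡ (*-congˡ d+t≈0) ⟩
    b + v * 0#                 ≈⟨ +-congˡ (zeroʳ v) ⟩
    b + 0#                     ≈⟨ +-identityʳ b ⟩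
    b                          ∎
    where v = eval f t
  quotient-remainder {d} {t} d+t≈0 (b ∷ f) (suc k) = begin
    -- Past the constant term, the leading `1#` of the divisor contributes `v`. This is the
    -- remainder for the tail `f`, so the induction hypothesis applies.
    coeff (C (v * 1#) +ᵖ p) k      ≈⟨ coeff-+ᵖ (C (v * 1#)) p k ⟩
    coeff (C (v * 1#)) k + coeff p k
      ≈⟨ +-congʳ (coeff-C-cong (*-identityʳ v) k) ⟩
    coeff (C v) k + coeff p k      ≈⟨ coeff-+ᵖ (C v) p k ⟨
    coeff (C v +ᵖ p) k             ≈⟨ quotient-remainder d+t≈0 f k ⟩
    coeff f k                      ∎
    where
    v = eval f t
    p = quotient t f *ᵖ (d ∷ 1# ∷ [])

  factor-theorem : ∀ {d t} → d + t ≈ 0# → ∀ f → eval f t ≈ 0# →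
                   (d ∷ 1# ∷ []) ∣ᵖ f
  factor-theorem {d} {t} d+t≈0 f ft≈0 = record
    { quotient = quotient t f
    ; equality = λ k → begin
        coeff p k                          ≈⟨ +-identityˡ _ ⟨
        0# + coeff p k                     ≈⟨ +-congʳ (C-0 k) ⟨
        coeff (C (eval f t)) k + coeff p k ≈⟨ coeff-+ᵖ (C (eval f t)) p k ⟨
        coeff (C (eval f t) +ᵖ p) k        ≈⟨ quotient-remainder d+t≈0 f k ⟩
        coeff f k                          ∎
    }
    where
    p = quotient t f *ᵖ (d ∷ 1# ∷ [])
    C-0 : C (eval f t) ≈ᵖ []
    C-0 zero    = ft≈0
    C-0 (suc k) = refl

-- Odd characteristic.

module OddOrder {c ℓ q} (F : FiniteField c ℓ q) (q-odd : Odd q) where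
  open FiniteField F hiding (_^_)
  open Inverse cardinality
    using (to; from; to-cong; strictlyInverseˡ; strictlyInverseʳ)
  open Relation.Binary.Reasoning.Setoid setoid
  open Algebra.Properties.Semiring.Mult semiring using (×1-homo-*)
    renaming (_×_ to _·_)
  open Algebra.Properties.Semiring.Sum semiring
  open Algebra.Properties.AbelianGroup +-abelianGroup using (identityʳ-unique)

  -- Translation is carried over to indices so that a sum over the field becomes a finite sum that
  -- can be permuted.
  translate : Carrier → Fin q → Fin q
  translate x i = to (from i + x)

  translate-inverse : ∀ x y → x + y ≈ 0# → ∀ i → translate y (translate x i) ≡ i
  translate-inverse x y x+y≈0 i = ≡.trans (to-cong (begin
    from (to (from i + x)) + y ≈⟨ +-congʳ (strictlyInverseʳ _) ⟩
    from i + x + y             ≈⟨ +-assoc _ x y ⟩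
    from i + (x + y)           ≈⟨ +-congˡ x+y≈0 ⟩
    from i + 0#                ≈⟨ +-identityʳ _ ⟩
    from i                     ∎)) (strictlyInverseˡ i)

  translation : Permutation′ q
  translation = permutation (translate 1#) (translate (- 1#))
    (translate-inverse (- 1#) 1# (-‿inverseˡ 1#))
    (translate-inverse 1# (- 1#) (-‿inverseʳ 1#))

  q·1≈0 : q · 1# ≈ 0#
  q·1≈0 = identityʳ-unique (sum from) (q · 1#) (begin
    sum from + q · 1#                      ≈⟨ +-congˡ (sum-replicate q) ⟨
    sum from + sum {q} (λ _ → 1#)          ≈⟨ ∑-distrib-+ from (λ _ → 1#) ⟨
    sum (λ i → from i + 1#)                ≈⟨ sum-cong-≋ (λ i → strictlyInverseʳ (from i + 1#)) ⟨
    sum (λ i → from (translation ⟨$⟩ʳ i))  ≈⟨ sum-permute from translation ⟨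
    sum from                               ∎)

  1+1≉0 : 1# + 1# ≉ 0#
  1+1≉0 1+1≈0 with k , ≡.refl ← odd⇒1+2k q q-odd = 1≉0 (begin
    1#                          ≈⟨ +-identityʳ 1# ⟨
    -- With q = 1 + 2k, the zero is expanded as (2 · 1)(k · 1) in order to reach `q · 1#`.
    1# + 0#                     ≈⟨ +-congˡ (zeroˡ (k · 1#)) ⟨
    1# + 0# * (k · 1#)          ≈⟨ +-congˡ (*-congʳ 2·1≈0) ⟨
    1# + (2 · 1#) * (k · 1#)    ≈⟨ +-congˡ (×1-homo-* 2 k) ⟨
    suc (2 ℕ.* k) · 1#          ≈⟨ q·1≈0 ⟩
    0#                          ∎)
    where
    2·1≈0 : 2 · 1# ≈ 0#
    2·1≈0 = trans (+-congˡ (+-identityʳ 1#)) 1+1≈0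

  x≈-x⇒x≈0 : ∀ x → x ≈ - x → x ≈ 0#
  x≈-x⇒x≈0 x x≈-x with ½ , ½*2≈1 , _ ← invertible (1# + 1#) 1+1≉0 = begin
    x                      ≈⟨ *-identityˡ x ⟨
    1# * x                 ≈⟨ *-congʳ ½*2≈1 ⟨
    ½ * (1# + 1#) * x      ≈⟨ *-assoc ½ _ x ⟩
    ½ * ((1# + 1#) * x)    ≈⟨ *-congˡ (distribʳ x 1# 1#) ⟩
    ½ * (1# * x + 1# * x)  ≈⟨ *-congˡ (+-cong (*-identityˡ x) (*-identityˡ x)) ⟩
    ½ * (x + x)            ≈⟨ *-congˡ (+-congˡ x≈-x) ⟩
    ½ * (x - x)            ≈⟨ *-congˡ (-‿inverseʳ x) ⟩
    ½ * 0#                 ≈⟨ zeroʳ ½ ⟩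
    0#                     ∎

-- The reciprocal at a square root of a.

module ReciprocalProperties {c ℓ q} (F : FiniteField c ℓ q) where
  open FiniteField F hiding (_^_)
  open Reciprocal F
  open PolynomialProperties commutativeRing
  open Relation.Binary.Reasoning.Setoid setoid
  open Algebra.Properties.CommutativeSemiring.Exp commutativeSemiring
  open Algebra.Properties.Semiring.Sum semiring
  open Algebra.Properties.Ring ring using (-‿distribˡ-*; -‿distribʳ-*)
  open Algebra.Properties.AbelianGroup +-abelianGroup using (⁻¹-involutive)
  open Algebra.Properties.CommutativeSemigroup *-commutativeSemigroup
    using (x∙yz≈y∙xz)

  [t²]^i*t^[n∸i]≈t^n*t^i : ∀ {a t} → t ^ 2 ≈ a → ∀ {i n} → i ℕ.≤ n →
                           a ^ i * t ^ (n ℕ.∸ i) ≈ t ^ n * t ^ i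
  [t²]^i*t^[n∸i]≈t^n*t^i {a} {t} t²≈a {i} {n} i≤n = begin
    a ^ i * t ^ (n ℕ.∸ i)              ≈⟨ *-congʳ (^-congˡ i t²≈a) ⟨
    (t ^ 2) ^ i * t ^ (n ℕ.∸ i)        ≈⟨ *-congʳ (^-assocʳ t 2 i) ⟩
    t ^ (2 ℕ.* i) * t ^ (n ℕ.∸ i)      ≈⟨ ^-homo-* t (2 ℕ.* i) (n ℕ.∸ i) ⟨
    t ^ (2 ℕ.* i ℕ.+ (n ℕ.∸ i))        ≈⟨ ^-congʳ t (2i+[n∸i]≡n+i i≤n) ⟩
    t ^ (n ℕ.+ i)                      ≈⟨ ^-homo-* t n i ⟩
    t ^ n * t ^ i                      ∎

  -- Morally f(a/t) = f(t), since a/t = t; computing term by term avoids dividing by `t`.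
  eval-reciprocal : ∀ {a t} → t ^ 2 ≈ a → ∀ n f (b₀≉0 : coeff f 0 ≉ 0#) →
    (∀ k → n ℕ.< k → coeff f k ≈ 0#) →
    eval (reciprocal a n f b₀≉0) t ≈ inverse (coeff f 0) b₀≉0 * (t ^ n * eval f t)
  eval-reciprocal {a} {t} t²≈a n f b₀≉0 bound = begin
    eval (reciprocal a n f b₀≉0) t          ≈⟨ eval-·ᵖ b₀⁻¹ (sumᵖ term) t ⟩
    b₀⁻¹ * eval (sumᵖ term) t               ≈⟨ *-congˡ (eval-sumᵖ term t) ⟩
    b₀⁻¹ * sum (λ i → eval (term i) t)      ≈⟨ *-congˡ (sum-cong-≋ eval-term) ⟩
    b₀⁻¹ * sum {suc n} (λ i → t ^ n * (coeff f (toℕ i) * t ^ toℕ i))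
      ≈⟨ *-congˡ (*-distribˡ-sum {suc n} (t ^ n) (λ i → coeff f (toℕ i) * t ^ toℕ i)) ⟨
    b₀⁻¹ * (t ^ n * sum {suc n} (λ i → coeff f (toℕ i) * t ^ toℕ i))
      -- `n ℕ.< k` unfolds to `suc n ℕ.≤ k`, so `bound` fits the exclusive bound `suc n` as it
      -- stands.
      ≈⟨ *-congˡ (*-congˡ (eval≈∑ (suc n) f t bound)) ⟨
    b₀⁻¹ * (t ^ n * eval f t)               ∎
    where
    b₀⁻¹ = inverse (coeff f 0) b₀≉0
    term : Fin (suc n) → Poly
    term i = monomial (coeff f (toℕ i) * a ^ toℕ i) (n ℕ.∸ toℕ i)
    eval-term : ∀ i → eval (term i) t ≈ t ^ n * (coeff f (toℕ i) * t ^ toℕ i)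
    eval-term i = begin
      eval (term i) t                              ≈⟨ eval-monomial _ (n ℕ.∸ toℕ i) t ⟩
      coeff f (toℕ i) * a ^ toℕ i * t ^ (n ℕ.∸ toℕ i) ≈⟨ *-assoc _ _ _ ⟩
      coeff f (toℕ i) * (a ^ toℕ i * t ^ (n ℕ.∸ toℕ i))
        ≈⟨ *-congˡ ([t²]^i*t^[n∸i]≈t^n*t^i t²≈a (toℕ≤pred[n] i)) ⟩
      coeff f (toℕ i) * (t ^ n * t ^ toℕ i)        ≈⟨ x∙yz≈y∙xz _ (t ^ n) _ ⟩
      t ^ n * (coeff f (toℕ i) * t ^ toℕ i)        ∎

  root : Odd q → ∀ {a t} → t ^ 2 ≈ a → ∀ n f →
         (∀ k → n ℕ.< k → coeff f k ≈ 0#) → SelfReciprocal a n f →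
         coeff f 0 ≈ - (t ^ n) → eval f t ≈ 0#
  root q-odd {a} {t} t²≈a n f bound (b₀≉0 , f̂≈f) b₀≈-tⁿ =
    OddOrder.x≈-x⇒x≈0 F q-odd (eval f t) (begin
      eval f t                          ≈⟨ eval-cong (reciprocal a n f b₀≉0) f t f̂≈f ⟨
      eval (reciprocal a n f b₀≉0) t    ≈⟨ eval-reciprocal t²≈a n f b₀≉0 bound ⟩
      b₀⁻¹ * (t ^ n * eval f t)         ≈⟨ *-assoc b₀⁻¹ _ _ ⟨
      -- The sign enters here: the factor tⁿ / b₀ becomes `- 1#`.
      b₀⁻¹ * t ^ n * eval f t           ≈⟨ *-congʳ (*-congˡ tⁿ≈-b₀) ⟩
      b₀⁻¹ * - coeff f 0 * eval f t     ≈⟨ *-congʳ (-‿distribʳ-* b₀⁻¹ _) ⟨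
      - (b₀⁻¹ * coeff f 0) * eval f t   ≈⟨ *-congʳ (-‿cong b₀⁻¹*b₀≈1) ⟩
      - 1# * eval f t                   ≈⟨ -‿distribˡ-* 1# _ ⟨
      - (1# * eval f t)                 ≈⟨ -‿cong (*-identityˡ _) ⟩
      - eval f t                        ∎)
    where
    b₀⁻¹ = inverse (coeff f 0) b₀≉0
    b₀⁻¹*b₀≈1 : b₀⁻¹ * coeff f 0 ≈ 1#
    b₀⁻¹*b₀≈1 = proj₁ (proj₂ (invertible (coeff f 0) b₀≉0))
    tⁿ≈-b₀ : t ^ n ≈ - coeff f 0
    tⁿ≈-b₀ = trans (sym (⁻¹-involutive _)) (-‿cong (sym b₀≈-tⁿ))

-- Divisibility at the two square roots.

theorem2 :
    ∀ {c ℓ} (q : ℕ) → OddPrimePower q → (F : FiniteField c ℓ q) →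
    let open FiniteField F
        open Reciprocal F
    in
    (n : ℕ) → Odd n →
    (a √a : Carrier) → a ≉ 0# → √a ^ 2 ≈ a →
    (f : Poly) → MonicOfDegree n f → SelfReciprocal a n f →
    (coeff f 0 ≈ √a ^ n → (X +ᵖ C √a) ∣ᵖ f) ×
    (coeff f 0 ≈ - (√a ^ n) → (X -ᵖ C √a) ∣ᵖ f)
theorem2 q q-pp F n n-odd a √a _ √a²≈a f (_ , bound) f-sr =
  part₁ , part₂
  where
  open FiniteField F
  open Reciprocal F
  open PolynomialProperties commutativeRing
  open ReciprocalProperties F
  open OddPrimePower q-pp using (q-odd)
  open Algebra.Properties.AbelianGroup +-abelianGroup using (⁻¹-involutive)

  [-√a]ⁿ≈-√aⁿ : (- √a) ^ n ≈ - (√a ^ n)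
  [-√a]ⁿ≈-√aⁿ with k , ≡.refl ← odd⇒1+2k n n-odd = [-x]^[1+2k]≈-x^[1+2k] √a k

  part₁ : coeff f 0 ≈ √a ^ n → (X +ᵖ C √a) ∣ᵖ f
  part₁ b₀≈√aⁿ = factor-theorem
    -- `X +ᵖ C √a` computes to `(0# + √a) ∷ 1# ∷ []`, so `d` is `0# + √a` and the root is `- √a`.
    (trans (+-congʳ (+-identityˡ √a)) (-‿inverseʳ √a)) f
    (root q-odd (trans ([-x]²≈x² √a) √a²≈a) n f bound f-sr
      -- As `n` is odd, `√a ^ n` equals `- ((- √a) ^ n)`, the form that `root` requires at `- √a`.
      (trans b₀≈√aⁿ (trans (sym (⁻¹-involutive _)) (-‿cong (sym [-√a]ⁿ≈-√aⁿ)))))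

  part₂ : coeff f 0 ≈ - (√a ^ n) → (X -ᵖ C √a) ∣ᵖ f
  part₂ b₀≈-√aⁿ = factor-theorem
    (trans (+-congʳ (+-identityˡ (- √a))) (-‿inverseˡ √a)) f
    (root q-odd √a²≈a n f bound f-sr b₀≈-√aⁿ)
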